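{- For every real $\alpha > 1$ there exist a constant $c>0$ and an infinite family of 3-layered DAGs $G = (V = V_1 \cup V_2 \cup V_3, E, w)$ with positive edge weights and with $|V|$ unbounded over the family, such that for every $G$ in the family $|V_2| = 3$ and every $\alpha$-stretch gap-1 shortest-paths preserver $H = (V, E, w_H)$ of $G$ satisfies $$\max_{e \in E} w_H(e) \ge 2^{c|V|}$$ (that is, $\max_{e\in E} w_H(e) \ge 2^{\Omega(|V|)}$).
   Context: Graphs are finite. A 3-layered DAG is a directed graph whose vertex set is a disjoint union $V = V_1 \cup V_2 \cup V_3$ and all of whose edges go from $V_1$ to $V_2$ or from $V_2$ to $V_3$. Edge weights $w$ are positive reals; the weight of a path is the sum of the weights of its edges; a shortest path is a directed path of minimum weight between its endpoints, and $\mathrm{dist}_G(s,t)$ is that minimum weight. Given $G=(V,E,w)$, a graph $H=(V,E,w_H)$ on the same vertex and edge set with positive real edge weights $w_H$ is an $\alpha$-stretch shortest-paths preserver of $G$ if every shortest path $\pi$ in $H$, say from $s$ to $t$, satisfies $w(\pi)\le \alpha\cdot \mathrm{dist}_G(s,t)$. It is an $\alpha$-stretch gap-1 shortest-paths preserver if, in addition, for any shortest path $\pi$ in $H$ and any path $\pi'$ with the same endpoints that is not a shortest path in $H$, we have $w_H(\pi)+1\le w_H(\pi')$. -}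

module Defs where

open import Data.Bool.Base using (Bool; T)
open import Data.Fin.Base using (Fin)
open import Data.Integer.Base using (+_)
open import Data.Nat.Base as ℕ using (ℕ; zero; suc)
import Data.Nat.Properties as ℕ
open import Data.Product.Base using (Σ-syntax; ∃-syntax; _×_; _,_)
open import Data.Rational.Base as ℚ using (ℚ; 0ℚ; 1ℚ; ∣_∣)
import Data.Rational.Properties as ℚ
open import Data.Rational.Solver using (module +-*-Solver)
open import Data.Sum.Base using (_⊎_; inj₁; inj₂)
open import Relation.Binary.Construct.Closure.ReflexiveTransitive
  using (Star; ε; _◅_)
open import Relation.Binary.PropositionalEquality using (_≡_; refl; cong; subst; sym)
open import Relation.Nullary.Negation.Core using (¬_)

-- Real numbers are Cauchy sequences of rationals with a modulus; their
-- equality is the relation _≈_ below.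

IsCauchy : (ℕ → ℚ) → Set
IsCauchy x = ∀ δ → 0ℚ ℚ.< δ →
  ∃[ N ] (∀ m n → N ℕ.≤ m → N ℕ.≤ n → ∣ x m ℚ.- x n ∣ ℚ.≤ δ)

record ℝ : Set where
  constructor mkℝ
  field
    seq    : ℕ → ℚ
    cauchy : IsCauchy seq

open ℝ public

private
  module _ where
    open +-*-Solver

    +-interchange : ∀ a b c d → (a ℚ.+ b) ℚ.- (c ℚ.+ d) ≡ (a ℚ.- c) ℚ.+ (b ℚ.- d)
    +-interchange = solve 4 (λ a b c d →
      (a :+ b) :- (c :+ d) := (a :- c) :+ (b :- d)) refl

    a≡b+[a-b] : ∀ a b → a ≡ b ℚ.+ (a ℚ.- b)
    a≡b+[a-b] = solve 2 (λ a b → a := b :+ (a :- b)) refl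

    *-difference : ∀ a b c d →
      a ℚ.* b ℚ.- c ℚ.* d ≡ a ℚ.* (b ℚ.- d) ℚ.+ d ℚ.* (a ℚ.- c)
    *-difference = solve 4 (λ a b c d →
      a :* b :- c :* d := a :* (b :- d) :+ d :* (a :- c)) refl

    factor : ∀ a b c d →
      a ℚ.* (c ℚ.* d) ℚ.+ b ℚ.* (c ℚ.* d) ≡ c ℚ.* ((a ℚ.+ b) ℚ.* d)
    factor = solve 4 (λ a b c d →
      a :* (c :* d) :+ b :* (c :* d) := c :* ((a :+ b) :* d)) refl

  open ℚ.≤-Reasoning

  ∣p*q∣≤a*b : ∀ p q {a b} → ∣ p ∣ ℚ.≤ a → ∣ q ∣ ℚ.≤ b → ∣ p ℚ.* q ∣ ℚ.≤ a ℚ.* b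
  ∣p*q∣≤a*b p q {a} {b} p≤a q≤b = begin
    ∣ p ℚ.* q ∣
      ≡⟨ ℚ.∣p*q∣≡∣p∣*∣q∣ p q ⟩
    ∣ p ∣ ℚ.* ∣ q ∣
      ≤⟨ ℚ.*-monoʳ-≤-nonNeg ∣ q ∣ {{ℚ.nonNegative (ℚ.0≤∣p∣ q)}} p≤a ⟩
    a ℚ.* ∣ q ∣
      ≤⟨ ℚ.*-monoˡ-≤-nonNeg a {{ℚ.nonNegative (ℚ.≤-trans (ℚ.0≤∣p∣ p) p≤a)}} q≤b ⟩
    a ℚ.* b ∎

  split : ∀ a b δ → 0ℚ ℚ.< a → 0ℚ ℚ.< b → 0ℚ ℚ.< δ →
    Σ[ η ∈ ℚ ] 0ℚ ℚ.< η × a ℚ.* η ℚ.+ b ℚ.* η ≡ δ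
  split a b δ 0<a 0<b 0<δ = δ ℚ.* r
    , ℚ.positive⁻¹ (δ ℚ.* r)
        {{ℚ.pos*pos⇒pos δ {{ℚ.positive 0<δ}} r {{ℚ.1/pos⇒pos (a ℚ.+ b) {{K>0}}}}}}
    , (begin-equality
      a ℚ.* (δ ℚ.* r) ℚ.+ b ℚ.* (δ ℚ.* r) ≡⟨ factor a b δ r ⟩
      δ ℚ.* ((a ℚ.+ b) ℚ.* r)
        ≡⟨ cong (δ ℚ.*_) (ℚ.*-inverseʳ (a ℚ.+ b) {{K≠0}}) ⟩
      δ ℚ.* 1ℚ                            ≡⟨ ℚ.*-identityʳ δ ⟩
      δ                                   ∎)
    where
    K>0 : ℚ.Positive (a ℚ.+ b)
    K>0 = ℚ.positive (ℚ.+-mono-< 0<a 0<b)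
    K≠0 : ℚ.NonZero (a ℚ.+ b)
    K≠0 = ℚ.pos⇒nonZero (a ℚ.+ b) {{K>0}}
    r : ℚ
    r = (ℚ.1/ (a ℚ.+ b)) {{K≠0}}

  0<1 : 0ℚ ℚ.< 1ℚ
  0<1 = ℚ.positive⁻¹ 1ℚ

  const-cauchy : ∀ q → IsCauchy (λ _ → q)
  const-cauchy q δ 0<δ = 0 , λ _ _ _ _ → begin
    ∣ q ℚ.- q ∣ ≡⟨ cong ∣_∣ (ℚ.+-inverseʳ q) ⟩
    0ℚ          ≤⟨ ℚ.<⇒≤ 0<δ ⟩
    δ           ∎

  +-estimate : ∀ a b c d {η θ} → ∣ a ℚ.- c ∣ ℚ.≤ η → ∣ b ℚ.- d ∣ ℚ.≤ θ →
    ∣ (a ℚ.+ b) ℚ.- (c ℚ.+ d) ∣ ℚ.≤ η ℚ.+ θ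
  +-estimate a b c d {η} {θ} a-c≤η b-d≤θ = begin
    ∣ (a ℚ.+ b) ℚ.- (c ℚ.+ d) ∣       ≡⟨ cong ∣_∣ (+-interchange a b c d) ⟩
    ∣ (a ℚ.- c) ℚ.+ (b ℚ.- d) ∣       ≤⟨ ℚ.∣p+q∣≤∣p∣+∣q∣ (a ℚ.- c) (b ℚ.- d) ⟩
    ∣ a ℚ.- c ∣ ℚ.+ ∣ b ℚ.- d ∣       ≤⟨ ℚ.+-mono-≤ a-c≤η b-d≤θ ⟩
    η ℚ.+ θ                           ∎

  *-estimate : ∀ a b c d {A D η} → ∣ a ∣ ℚ.≤ A → ∣ d ∣ ℚ.≤ D →
    ∣ a ℚ.- c ∣ ℚ.≤ η → ∣ b ℚ.- d ∣ ℚ.≤ η →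
    ∣ a ℚ.* b ℚ.- c ℚ.* d ∣ ℚ.≤ A ℚ.* η ℚ.+ D ℚ.* η
  *-estimate a b c d {A} {D} {η} a≤A d≤D a-c≤η b-d≤η = begin
    ∣ a ℚ.* b ℚ.- c ℚ.* d ∣
      ≡⟨ cong ∣_∣ (*-difference a b c d) ⟩
    ∣ a ℚ.* (b ℚ.- d) ℚ.+ d ℚ.* (a ℚ.- c) ∣
      ≤⟨ ℚ.∣p+q∣≤∣p∣+∣q∣ (a ℚ.* (b ℚ.- d)) (d ℚ.* (a ℚ.- c)) ⟩
    ∣ a ℚ.* (b ℚ.- d) ∣ ℚ.+ ∣ d ℚ.* (a ℚ.- c) ∣
      ≤⟨ ℚ.+-mono-≤ (∣p*q∣≤a*b a (b ℚ.- d) a≤A b-d≤η)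
                    (∣p*q∣≤a*b d (a ℚ.- c) d≤D a-c≤η) ⟩
    A ℚ.* η ℚ.+ D ℚ.* η ∎

  +-cauchy : ∀ x y → IsCauchy x → IsCauchy y → IsCauchy (λ n → x n ℚ.+ y n)
  +-cauchy x y cx cy δ 0<δ =
    let η , 0<η , η+η≡δ = split 1ℚ 1ℚ δ 0<1 0<1 0<δ
        Nx , hx = cx (1ℚ ℚ.* η) (0<1*η η 0<η)
        Ny , hy = cy (1ℚ ℚ.* η) (0<1*η η 0<η)
    in Nx ℕ.⊔ Ny , λ m n N≤m N≤n →
      ℚ.≤-trans
        (+-estimate (x m) (y m) (x n) (y n)
          (hx m n (ℕ.m⊔n≤o⇒m≤o Nx Ny N≤m) (ℕ.m⊔n≤o⇒m≤o Nx Ny N≤n))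
          (hy m n (ℕ.m⊔n≤o⇒n≤o Nx Ny N≤m) (ℕ.m⊔n≤o⇒n≤o Nx Ny N≤n)))
        (ℚ.≤-reflexive η+η≡δ)
    where
    0<1*η : ∀ η → 0ℚ ℚ.< η → 0ℚ ℚ.< 1ℚ ℚ.* η
    0<1*η η = subst (0ℚ ℚ.<_) (sym (ℚ.*-identityˡ η))

  bound-estimate : ∀ a b {η} → ∣ a ℚ.- b ∣ ℚ.≤ η → ∣ a ∣ ℚ.≤ ∣ b ∣ ℚ.+ η
  bound-estimate a b {η} a-b≤η = begin
    ∣ a ∣                     ≡⟨ cong ∣_∣ (a≡b+[a-b] a b) ⟩
    ∣ b ℚ.+ (a ℚ.- b) ∣       ≤⟨ ℚ.∣p+q∣≤∣p∣+∣q∣ b (a ℚ.- b) ⟩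
    ∣ b ∣ ℚ.+ ∣ a ℚ.- b ∣     ≤⟨ ℚ.+-monoʳ-≤ ∣ b ∣ a-b≤η ⟩
    ∣ b ∣ ℚ.+ η               ∎

  eventually-bounded : ∀ x → IsCauchy x →
    Σ[ B ∈ ℚ ] 0ℚ ℚ.< B × ∃[ N ] (∀ n → N ℕ.≤ n → ∣ x n ∣ ℚ.≤ B)
  eventually-bounded x cx =
    let N , h = cx 1ℚ 0<1 in
      ∣ x N ∣ ℚ.+ 1ℚ
    , ℚ.+-mono-≤-< (ℚ.0≤∣p∣ (x N)) 0<1
    , N , λ n N≤n → bound-estimate (x n) (x N) (h n N N≤n ℕ.≤-refl)

  *-cauchy : ∀ x y → IsCauchy x → IsCauchy y → IsCauchy (λ n → x n ℚ.* y n)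
  *-cauchy x y cx cy δ 0<δ =
    let Bx , 0<Bx , Mx , bx = eventually-bounded x cx
        By , 0<By , My , by = eventually-bounded y cy
        η , 0<η , Bxη+Byη≡δ = split Bx By δ 0<Bx 0<By 0<δ
        Nx , hx = cx η 0<η
        Ny , hy = cy η 0<η
    in (Nx ℕ.⊔ Ny) ℕ.⊔ (Mx ℕ.⊔ My) , λ m n N≤m N≤n →
      let N≤m₁ = ℕ.m⊔n≤o⇒m≤o (Nx ℕ.⊔ Ny) (Mx ℕ.⊔ My) N≤m
          N≤m₂ = ℕ.m⊔n≤o⇒n≤o (Nx ℕ.⊔ Ny) (Mx ℕ.⊔ My) N≤m
          N≤n₁ = ℕ.m⊔n≤o⇒m≤o (Nx ℕ.⊔ Ny) (Mx ℕ.⊔ My) N≤n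
          N≤n₂ = ℕ.m⊔n≤o⇒n≤o (Nx ℕ.⊔ Ny) (Mx ℕ.⊔ My) N≤n
      in ℚ.≤-trans
        (*-estimate (x m) (y m) (x n) (y n)
          (bx m (ℕ.m⊔n≤o⇒m≤o Mx My N≤m₂))
          (by n (ℕ.m⊔n≤o⇒n≤o Mx My N≤n₂))
          (hx m n (ℕ.m⊔n≤o⇒m≤o Nx Ny N≤m₁) (ℕ.m⊔n≤o⇒m≤o Nx Ny N≤n₁))
          (hy m n (ℕ.m⊔n≤o⇒n≤o Nx Ny N≤m₁) (ℕ.m⊔n≤o⇒n≤o Nx Ny N≤n₁)))
        (ℚ.≤-reflexive Bxη+Byη≡δ)

infix  4 _≈_ _≤_ _<_ 2^_≤_
infixl 6 _+_
infixl 7 _*_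
infixr 8 _^_

fromℚ : ℚ → ℝ
fromℚ q = mkℝ (λ _ → q) (const-cauchy q)

fromℕ : ℕ → ℝ
fromℕ n = fromℚ (+ n ℚ./ 1)

0ℝ 1ℝ : ℝ
0ℝ = fromℚ 0ℚ
1ℝ = fromℚ 1ℚ

_+_ _*_ : ℝ → ℝ → ℝ
x + y = mkℝ (λ n → seq x n ℚ.+ seq y n) (+-cauchy (seq x) (seq y) (cauchy x) (cauchy y))
x * y = mkℝ (λ n → seq x n ℚ.* seq y n) (*-cauchy (seq x) (seq y) (cauchy x) (cauchy y))

_^_ : ℝ → ℕ → ℝ
x ^ zero  = 1ℝ
x ^ suc n = x * x ^ n

_≤_ _<_ _≈_ : ℝ → ℝ → Set
x ≤ y = ∀ δ → 0ℚ ℚ.< δ →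
  ∃[ N ] (∀ n → N ℕ.≤ n → seq x n ℚ.≤ seq y n ℚ.+ δ)
x < y = Σ[ δ ∈ ℚ ] 0ℚ ℚ.< δ ×
  ∃[ N ] (∀ n → N ℕ.≤ n → seq x n ℚ.+ δ ℚ.≤ seq y n)
x ≈ y = x ≤ y × y ≤ x

-- 2^ x ≤ y  for reals x ≥ 0 and y > 0 (the only arguments for which it is
-- meant).  Since 2ˣ is the supremum of 2^(p/q) over the rationals
-- 0 ≤ p/q ≤ x, the inequality says 2^(p/q) ≤ y, i.e. 2ᵖ ≤ y^q, for all those.
2^_≤_ : ℝ → ℝ → Set
2^ x ≤ y = ∀ (p q : ℕ) .{{_ : ℕ.NonZero q}} →
  fromℚ (+ p ℚ./ q) ≤ x → fromℕ (2 ℕ.^ p) ≤ y ^ q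

module _ {A B C : Set} where

  -- The vertex set V₁ ∪ V₂ ∪ V₃ is A ⊎ B ⊎ C.
  data Consecutive : A ⊎ B ⊎ C → A ⊎ B ⊎ C → Set where
    V₁→V₂ : ∀ a b → Consecutive (inj₁ a) (inj₂ (inj₁ b))
    V₂→V₃ : ∀ b c → Consecutive (inj₂ (inj₁ b)) (inj₂ (inj₂ c))

record LayeredDAG : Set where
  field
    ∣V₁∣ ∣V₂∣ ∣V₃∣ : ℕ

  Vertex : Set
  Vertex = Fin ∣V₁∣ ⊎ Fin ∣V₂∣ ⊎ Fin ∣V₃∣

  ∣V∣ : ℕ
  ∣V∣ = ∣V₁∣ ℕ.+ ∣V₂∣ ℕ.+ ∣V₃∣

  field
    adjacent : Vertex → Vertex → Bool

  Edge : Vertex → Vertex → Set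
  Edge u v = T (adjacent u v)

  field
    layered : ∀ {u v} → Edge u v → Consecutive u v

  Path : Vertex → Vertex → Set
  Path = Star Edge

record Weighting (G : LayeredDAG) : Set where
  open LayeredDAG G
  field
    weight   : ∀ {u v} → Edge u v → ℝ
    positive : ∀ {u v} (e : Edge u v) → 0ℝ < weight e

  pathWeight : ∀ {s t} → Path s t → ℝ
  pathWeight ε       = 0ℝ
  pathWeight (e ◅ π) = weight e + pathWeight π

  IsShortest : ∀ {s t} → Path s t → Set
  IsShortest {s} {t} π = ∀ (π′ : Path s t) → pathWeight π ≤ pathWeight π′

  IsDist : Vertex → Vertex → ℝ → Set
  IsDist s t d = Σ[ π ∈ Path s t ] IsShortest π × d ≈ pathWeight π

record WeightedLayeredDAG : Set where
  field
    graph     : LayeredDAG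
    weighting : Weighting graph

  open LayeredDAG graph public
  open Weighting weighting public

-- A graph H on the vertices and edges of G is given by its weighting.
module _ (α : ℝ) (G : WeightedLayeredDAG) (H : Weighting (WeightedLayeredDAG.graph G)) where
  private
    module G = WeightedLayeredDAG G
    module H = Weighting H

  IsPreserver : Set
  IsPreserver = ∀ {s t} (π : G.Path s t) → H.IsShortest π →
    ∀ d → G.IsDist s t d → G.pathWeight π ≤ α * d

  IsGap1Preserver : Set
  IsGap1Preserver = IsPreserver ×
    (∀ {s t} (π π′ : G.Path s t) → H.IsShortest π → ¬ H.IsShortest π′ →
      H.pathWeight π + 1ℝ ≤ H.pathWeight π′)

{-# OPTIONS --safe #-}

-- With three middle vertices, a preserver of G only sees, for a source s and a
-- target t, which middle vertex is cheapest.  If A ≥ α and the weights of G are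
-- powers of B = 2A, then this is the middle vertex b minimising
-- max (σ s b) (τ t b), where σ and τ are the exponents; so G obeys a "min-max"
-- rule, while every gap-1 preserver H has to obey the same comparisons
-- additively.
--
-- Let the source S r j k have the exponents 2r + 1 at k and 0 at j, and let
-- rise r (j , k) be the H-weight of its edge to k minus that of its edge to j.
-- A target with exponents 2r + 4 at j, 2r + 2 at l and 0 at k separates the
-- sources of levels r + 2, r + 1 and r so that
--   rise (r + 2) (j , k) ≥ rise (r + 1) (j , l) + rise r (l , k).
-- Summing over the six ordered pairs (j , k) gives a total that is independent
-- of the offsets of the middle vertices, is positive at every level, and grows
-- at least like the Fibonacci numbers; hence one of six edges at the last level
-- is exponentially heavy.

module Submission where

open import Defs
open import Data.Bool.Base using (Bool; true; false; T; if_then_else_)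
open import Data.Empty using (⊥; ⊥-elim)
open import Data.Fin.Base as Fin using (Fin; toℕ; combine; remQuot)
open import Data.Fin.Patterns using (0F; 1F; 2F)
import Data.Fin.Properties as Fin
import Data.Integer.Base as ℤ
import Data.Integer.Properties as ℤ
open import Data.List.Base as List using (List; []; _∷_; length)
open import Data.List.Relation.Unary.All as All using (All; []; _∷_)
open import Data.List.Relation.Unary.Any using (Any; here; there; satisfied)
open import Data.Nat.Base as ℕ using (ℕ; zero; suc)
open import Data.Nat.DivMod using (_mod_; m<n⇒m%n≡m; m%n<n)
import Data.Nat.Properties as ℕ
open import Data.Nat.Solver renaming (module +-*-Solver to ℕ-Solver)
open import Data.Product.Base using (Σ-syntax; ∃-syntax; _×_; _,_; proj₁; proj₂)
open import Data.Rational.Base as ℚ using (ℚ; mkℚ; 0ℚ; 1ℚ; ½; ∣_∣)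
import Data.Rational.Properties as ℚ
open import Data.Rational.Solver using (module +-*-Solver)
import Data.Rational.Unnormalised.Base as ℚᵘ
import Data.Rational.Unnormalised.Properties as ℚᵘ
open import Data.Sum.Base as Sum using (_⊎_; inj₁; inj₂)
open import Data.Unit.Base using (tt)
open import Function.Base using (_∘_)
open import Relation.Binary.Construct.Closure.ReflexiveTransitive using (ε; _◅_)
open import Relation.Binary.PropositionalEquality
open import Relation.Nullary using (¬_; yes; no; does)
open import Relation.Nullary.Decidable using (dec-true; dec-false)
open WeightedLayeredDAG using (graph; Vertex; Edge; ∣V∣; ∣V₂∣)

-- Rational and real arithmetic

ι : ℕ → ℚ
ι n = ℤ.+ n ℚ./ 1

toℚᵘ-/ : ∀ i n .{{_ : ℕ.NonZero n}} → ℚ.toℚᵘ (i ℚ./ n) ℚᵘ.≃ i ℚᵘ./ n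
toℚᵘ-/ i (suc n) = ℚ.toℚᵘ-fromℚᵘ (ℚᵘ.mkℚᵘ i n)

ι-+ : ∀ m n → ι (m ℕ.+ n) ≡ ι m ℚ.+ ι n
ι-+ m n = ℚ.toℚᵘ-injective (begin-equality
  ℚ.toℚᵘ (ι (m ℕ.+ n))              ≃⟨ toℚᵘ-/ (ℤ.+ (m ℕ.+ n)) 1 ⟩
  ℤ.+ (m ℕ.+ n) ℚᵘ./ 1              ≃⟨ ℚᵘ.*≡* (cong (ℤ._* ℤ.1ℤ) (sym (cong₂ ℤ._+_ (ℤ.*-identityʳ (ℤ.+ m)) (ℤ.*-identityʳ (ℤ.+ n))))) ⟩
  ℤ.+ m ℚᵘ./ 1 ℚᵘ.+ ℤ.+ n ℚᵘ./ 1    ≃⟨ ℚᵘ.+-cong (toℚᵘ-/ (ℤ.+ m) 1) (toℚᵘ-/ (ℤ.+ n) 1) ⟨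
  ℚ.toℚᵘ (ι m) ℚᵘ.+ ℚ.toℚᵘ (ι n)    ≃⟨ ℚ.toℚᵘ-homo-+ (ι m) (ι n) ⟨
  ℚ.toℚᵘ (ι m ℚ.+ ι n)              ∎)
  where open ℚᵘ.≤-Reasoning

ι-* : ∀ m n → ι (m ℕ.* n) ≡ ι m ℚ.* ι n
ι-* m n = ℚ.toℚᵘ-injective (begin-equality
  ℚ.toℚᵘ (ι (m ℕ.* n))              ≃⟨ toℚᵘ-/ (ℤ.+ (m ℕ.* n)) 1 ⟩
  ℤ.+ (m ℕ.* n) ℚᵘ./ 1              ≃⟨ ℚᵘ.*≡* (cong (ℤ._* ℤ.1ℤ) (ℤ.pos-* m n)) ⟩
  (ℤ.+ m ℚᵘ./ 1) ℚᵘ.* (ℤ.+ n ℚᵘ./ 1)  ≃⟨ ℚᵘ.*-cong (toℚᵘ-/ (ℤ.+ m) 1) (toℚᵘ-/ (ℤ.+ n) 1) ⟨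
  ℚ.toℚᵘ (ι m) ℚᵘ.* ℚ.toℚᵘ (ι n)    ≃⟨ ℚ.toℚᵘ-homo-* (ι m) (ι n) ⟨
  ℚ.toℚᵘ (ι m ℚ.* ι n)              ∎)
  where open ℚᵘ.≤-Reasoning

ι-mono : ∀ {m n} → m ℕ.≤ n → ι m ℚ.≤ ι n
ι-mono {m} {n} m≤n = ℚ.toℚᵘ-cancel-≤ (begin
  ℚ.toℚᵘ (ι m)  ≃⟨ toℚᵘ-/ (ℤ.+ m) 1 ⟩
  ℤ.+ m ℚᵘ./ 1  ≤⟨ ℚᵘ.*≤* (ℤ.*-monoʳ-≤-nonNeg ℤ.1ℤ (ℤ.+≤+ m≤n)) ⟩
  ℤ.+ n ℚᵘ./ 1  ≃⟨ toℚᵘ-/ (ℤ.+ n) 1 ⟨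
  ℚ.toℚᵘ (ι n)  ∎)
  where open ℚᵘ.≤-Reasoning

/≤ι⇒≤* : ∀ p q m .{{_ : ℕ.NonZero q}} → ℤ.+ p ℚ./ q ℚ.≤ ι m → p ℕ.≤ m ℕ.* q
/≤ι⇒≤* p q@(suc _) m p/q≤m = ℤ.drop‿+≤+ (begin
  ℤ.+ p            ≡⟨ ℤ.*-identityʳ (ℤ.+ p) ⟨
  ℤ.+ p ℤ.* ℤ.1ℤ   ≤⟨ ℚᵘ.drop-*≤* p/q≤ᵘm ⟩
  ℤ.+ m ℤ.* ℤ.+ q  ≡⟨ ℤ.pos-* m q ⟨
  ℤ.+ (m ℕ.* q)    ∎)
  where
  open ℤ.≤-Reasoning
  p/q≤ᵘm : ℤ.+ p ℚᵘ./ q ℚᵘ.≤ ℤ.+ m ℚᵘ./ 1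
  p/q≤ᵘm = ℚᵘ.≤-respˡ-≃ (toℚᵘ-/ (ℤ.+ p) q) (ℚᵘ.≤-respʳ-≃ (toℚᵘ-/ (ℤ.+ m) 1) (ℚ.toℚᵘ-mono-≤ p/q≤m))

-- The denominator is at least 1, so the absolute value of the numerator is already an upper bound.
≤∣ι∣ : ∀ p → p ℚ.≤ ι ℤ.∣ ℚ.↥ p ∣
≤∣ι∣ p@(mkℚ i d-1 _) = ℚ.toℚᵘ-cancel-≤ (ℚᵘ.≤-respʳ-≃ (ℚᵘ.≃-sym (toℚᵘ-/ (ℤ.+ ℤ.∣ i ∣) 1)) (ℚᵘ.*≤* (begin
  i ℤ.* ℤ.1ℤ                       ≡⟨ ℤ.*-identityʳ i ⟩
  i                                ≤⟨ i≤∣i∣ i ⟩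
  ℤ.+ ℤ.∣ i ∣                      ≤⟨ ℤ.+≤+ (ℕ.m≤m*n ℤ.∣ i ∣ (suc d-1)) ⟩
  ℤ.+ (ℤ.∣ i ∣ ℕ.* suc d-1)        ≡⟨ ℤ.pos-* ℤ.∣ i ∣ (suc d-1) ⟩
  ℤ.+ ℤ.∣ i ∣ ℤ.* ℤ.+ suc d-1      ∎)))
  where
  open ℤ.≤-Reasoning
  i≤∣i∣ : ∀ i → i ℤ.≤ ℤ.+ ℤ.∣ i ∣
  i≤∣i∣ (ℤ.+ n)    = ℤ.≤-refl
  i≤∣i∣ ℤ.-[1+ n ] = ℤ.-≤+

0<½ : 0ℚ ℚ.< ½
0<½ = ℚ.positive⁻¹ ½

0<1 : 0ℚ ℚ.< 1ℚ
0<1 = ℚ.positive⁻¹ 1ℚ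

-- Proves a linear inequality from a suitable combination of known ones.
≤-by-difference : ∀ {a b c d} → a ℚ.≤ b → d ℚ.- c ≡ b ℚ.- a → c ℚ.≤ d
≤-by-difference {a} {b} {c} {d} a≤b eq = begin
  c                  ≡⟨ ℚ.+-identityʳ c ⟨
  c ℚ.+ 0ℚ           ≡⟨ cong (c ℚ.+_) (ℚ.+-inverseʳ a) ⟨
  c ℚ.+ (a ℚ.- a)    ≤⟨ ℚ.+-monoʳ-≤ c (ℚ.+-monoˡ-≤ (ℚ.- a) a≤b) ⟩
  c ℚ.+ (b ℚ.- a)    ≡⟨ cong (c ℚ.+_) eq ⟨
  c ℚ.+ (d ℚ.- c)    ≡⟨ solve 2 (λ c d → c :+ (d :- c) := d) refl c d ⟩
  d                  ∎
  where
  open ℚ.≤-Reasoning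
  open +-*-Solver

half-gap : ∀ {a b} → a ℚ.< b → Σ[ δ ∈ ℚ ] 0ℚ ℚ.< δ × a ℚ.+ δ ℚ.+ δ ≡ b
half-gap {a} {b} a<b = ½ ℚ.* (b ℚ.- a)
  , subst (ℚ._< ½ ℚ.* (b ℚ.- a)) (ℚ.*-zeroʳ ½)
      (ℚ.*-monoʳ-<-pos ½ (subst (ℚ._< b ℚ.- a) (ℚ.+-inverseʳ a) (ℚ.+-monoˡ-< (ℚ.- a) a<b)))
  , solve 2 (λ a b → a :+ con ½ :* (b :- a) :+ con ½ :* (b :- a) := b) refl a b
  where open +-*-Solver

0<δ⇒a<a+δ : ∀ a {δ} → 0ℚ ℚ.< δ → a ℚ.< a ℚ.+ δ
0<δ⇒a<a+δ a 0<δ = subst (ℚ._< a ℚ.+ _) (ℚ.+-identityʳ a) (ℚ.+-monoʳ-< a 0<δ)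

∀δ⇒≤ : ∀ {a b} → (∀ δ → 0ℚ ℚ.< δ → a ℚ.≤ b ℚ.+ δ) → a ℚ.≤ b
∀δ⇒≤ {a} {b} a≤b+δ = ℚ.≮⇒≥ λ b<a →
  let δ , 0<δ , b+2δ≡a = half-gap b<a in
  ℚ.<-irrefl refl (ℚ.<-≤-trans (subst (b ℚ.+ δ ℚ.<_) b+2δ≡a (0<δ⇒a<a+δ (b ℚ.+ δ) 0<δ)) (a≤b+δ δ 0<δ))

∣a-b∣≤δ⇒a≤b+δ : ∀ {a b δ} → ∣ a ℚ.- b ∣ ℚ.≤ δ → a ℚ.≤ b ℚ.+ δ
∣a-b∣≤δ⇒a≤b+δ {a} {b} {δ} ∣a-b∣≤δ =
  ≤-by-difference (ℚ.≤-trans (p≤∣p∣ (a ℚ.- b)) ∣a-b∣≤δ)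
    (solve 3 (λ a b δ → b :+ δ :- a := δ :- (a :- b)) refl a b δ)
  where
  open +-*-Solver
  p≤∣p∣ : ∀ p → p ℚ.≤ ∣ p ∣
  p≤∣p∣ p with ℚ.≤-total 0ℚ p
  ... | inj₁ 0≤p = ℚ.≤-reflexive (sym (ℚ.0≤p⇒∣p∣≡p 0≤p))
  ... | inj₂ p≤0 = ℚ.≤-trans p≤0 (ℚ.0≤∣p∣ p)

-- Eventual behaviour of sequences and the order on the reals.

Eventually : (ℕ → Set) → Set
Eventually P = ∃[ N ] (∀ n → N ℕ.≤ n → P n)

infixr 4 _∩_

_∩_ : ∀ {P Q} → Eventually P → Eventually Q → Eventually (λ n → P n × Q n)
(M , p) ∩ (N , q) = M ℕ.⊔ N , λ n M⊔N≤n →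
  p n (ℕ.m⊔n≤o⇒m≤o M N M⊔N≤n) , q n (ℕ.m⊔n≤o⇒n≤o M N M⊔N≤n)

eventually-map : ∀ {P Q : ℕ → Set} → (∀ n → P n → Q n) → Eventually P → Eventually Q
eventually-map f (N , p) = N , λ n N≤n → f n (p n N≤n)

eventually-⊥ : ¬ Eventually (λ _ → ⊥)
eventually-⊥ (N , p) = p N ℕ.≤-refl

-- A gap makes the comparison decidable: with `q = p + 2δ`, a single term after which the sequence
-- moves by at most `δ` is compared with the midpoint `p + δ`.
cauchy-choice : ∀ x {p q} → p ℚ.< q →
  Eventually (λ n → p ℚ.≤ seq x n) ⊎ Eventually (λ n → seq x n ℚ.≤ q)
cauchy-choice x {p} {q} p<q =
  let δ , 0<δ , p+2δ≡q = half-gap p<q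
      N , h = cauchy x δ 0<δ
  in Sum.map
    (λ p+δ≤x → N , λ n N≤n → ≤-by-difference
      (ℚ.≤-trans p+δ≤x (∣a-b∣≤δ⇒a≤b+δ (h N n ℕ.≤-refl N≤n)))
      (solve 3 (λ p δ x → x :- p := x :+ δ :- (p :+ δ)) refl p δ (seq x n)))
    (λ x≤p+δ → N , λ n N≤n → ℚ.≤-trans (∣a-b∣≤δ⇒a≤b+δ (h n N N≤n ℕ.≤-refl))
      (subst (seq x N ℚ.+ δ ℚ.≤_) p+2δ≡q (ℚ.+-monoˡ-≤ δ x≤p+δ)))
    (ℚ.≤-total (p ℚ.+ δ) (seq x N))
  where open +-*-Solver

bounded-by-ι : ∀ x → ∃[ A ] Eventually (λ n → seq x n ℚ.≤ ι A)
bounded-by-ι x with cauchy x 1ℚ 0<1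
... | N , h = ℤ.∣ ℚ.↥ (seq x N ℚ.+ 1ℚ) ∣ , N , λ n N≤n →
  ℚ.≤-trans (∣a-b∣≤δ⇒a≤b+δ (h n N N≤n ℕ.≤-refl)) (≤∣ι∣ (seq x N ℚ.+ 1ℚ))

halve : ∀ {δ} → 0ℚ ℚ.< δ → Σ[ η ∈ ℚ ] 0ℚ ℚ.< η × η ℚ.+ η ≡ δ
halve 0<δ = let η , 0<η , 0+2η≡δ = half-gap 0<δ in
  η , 0<η , trans (cong (ℚ._+ η) (sym (ℚ.+-identityˡ η))) 0+2η≡δ

≤-trans : ∀ {x y z} → x ≤ y → y ≤ z → x ≤ z
≤-trans {x} {y} {z} x≤y y≤z δ 0<δ =
  let η , 0<η , 2η≡δ = halve 0<δ in
  eventually-map (λ n (p , q) → begin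
    seq x n                  ≤⟨ p ⟩
    seq y n ℚ.+ η            ≤⟨ ℚ.+-monoˡ-≤ η q ⟩
    seq z n ℚ.+ η ℚ.+ η      ≡⟨ ℚ.+-assoc (seq z n) η η ⟩
    seq z n ℚ.+ (η ℚ.+ η)    ≡⟨ cong (seq z n ℚ.+_) 2η≡δ ⟩
    seq z n ℚ.+ δ            ∎) (x≤y η 0<η ∩ y≤z η 0<η)
  where open ℚ.≤-Reasoning

≤-pointwise : ∀ {x y} → Eventually (λ n → seq x n ℚ.≤ seq y n) → x ≤ y
≤-pointwise x≤y δ 0<δ =
  eventually-map (λ n p → ℚ.≤-trans p (ℚ.<⇒≤ (0<δ⇒a<a+δ _ 0<δ))) x≤y

≤-refl : ∀ {x} → x ≤ x
≤-refl {x} = ≤-pointwise {x} {x} (0 , λ _ _ → ℚ.≤-refl)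

<⇒≤ : ∀ {x y} → x < y → x ≤ y
<⇒≤ {x} {y} (δ , 0<δ , x+δ≤y) =
  ≤-pointwise {x} {y} (eventually-map (λ n → ℚ.≤-trans (ℚ.<⇒≤ (0<δ⇒a<a+δ _ 0<δ))) x+δ≤y)

<⇒≱ : ∀ {x y} → x < y → ¬ (y ≤ x)
<⇒≱ {x} {y} (δ , 0<δ , x+δ≤y) y≤x =
  let η , 0<η , 2η≡δ = halve 0<δ in
  eventually-⊥ (eventually-map (λ n (x+δ≤y , y≤x+η) →
    ℚ.<-irrefl refl (ℚ.<-≤-trans
      (ℚ.+-monoʳ-< (seq x n) (subst (η ℚ.<_) 2η≡δ (0<δ⇒a<a+δ η 0<η)))
      (ℚ.≤-trans x+δ≤y y≤x+η))) (x+δ≤y ∩ y≤x η 0<η))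

-- The difference of `x` and `y` is tested against the gap between `η = δ / 2` and `δ`.
approximately-≤⊎> : ∀ x y δ → 0ℚ ℚ.< δ →
  Eventually (λ n → seq x n ℚ.≤ seq y n ℚ.+ δ) ⊎ y < x
approximately-≤⊎> x y δ 0<δ =
  let η , 0<η , 2η≡δ = halve 0<δ in
  Sum.swap (Sum.map
    (λ η≤x-y → η , 0<η , eventually-map (λ n p → ≤-by-difference p (
      solve 3 (λ x y η → x :- (y :+ η) := x :+ y :* con (ℚ.- 1ℚ) :- η) refl (seq x n) (seq y n) η)) η≤x-y)
    (eventually-map (λ n p → ≤-by-difference p (
      solve 3 (λ x y δ → y :+ δ :- x := δ :- (x :+ y :* con (ℚ.- 1ℚ))) refl (seq x n) (seq y n) δ)))
    (cauchy-choice (x + y * fromℚ (ℚ.- 1ℚ)) (subst (η ℚ.<_) 2η≡δ (0<δ⇒a<a+δ η 0<η))))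
  where open +-*-Solver

≰⇒≥ : ∀ {x y} → ¬ (x ≤ y) → y ≤ x
≰⇒≥ {x} {y} x≰y δ 0<δ = Sum.[ (λ y≤x+δ → y≤x+δ)
  , (λ x<y → ⊥-elim (x≰y (<⇒≤ {x} {y} x<y))) ]′ (approximately-≤⊎> y x δ 0<δ)

-- At each tolerance the alternative `y < x` is refuted, which leaves the approximate bound. This
-- permits classical case distinctions wherever the goal is an inequality of reals.
≤-stable : ∀ {x y} → ¬ ¬ (x ≤ y) → x ≤ y
≤-stable {x} {y} ¬¬x≤y δ 0<δ = Sum.[ (λ x≤y+δ → x≤y+δ)
  , (λ y<x → ⊥-elim (¬¬x≤y (<⇒≱ {y} {x} y<x))) ]′ (approximately-≤⊎> x y δ 0<δ)

-- Finding the smaller of two reals is not constructive, so a minimiser is obtained only up to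
-- double negation; by `≤-stable` this suffices for proving inequalities.
¬¬-minimum : ∀ {n} (x : Fin (suc n) → ℝ) → ¬ ¬ (∃[ i ] ∀ j → x i ≤ x j)
¬¬-minimum {zero} x no-min = no-min (Fin.zero , λ { Fin.zero → ≤-refl {x Fin.zero} })
¬¬-minimum {suc n} x no-min = ¬¬-minimum (x ∘ Fin.suc) λ (i , i-min) →
  no-min (Fin.suc i , λ
    { Fin.zero → ≤-stable {x (Fin.suc i)} {x Fin.zero} λ i≰0 →
        let 0≤i = ≰⇒≥ {x (Fin.suc i)} {x Fin.zero} i≰0 in
        no-min (Fin.zero , λ
          { Fin.zero    → ≤-refl {x Fin.zero}
          ; (Fin.suc j) → ≤-trans {x Fin.zero} {x (Fin.suc i)} {x (Fin.suc j)} 0≤i (i-min j) })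
    ; (Fin.suc j) → i-min j })

-- Some index is minimal, up to double negation, and every index except `i` is excluded. For a
-- preserver: the one middle vertex not ruled out carries a shortest path.
only-candidate⇒minimum : ∀ {n} (x : Fin n → ℝ) i →
  (∀ j → j ≢ i → ¬ (∀ k → x j ≤ x k)) → ∀ k → x i ≤ x k
only-candidate⇒minimum {suc n} x i others k = ≤-stable {x i} {x k} λ xi≰xk →
  ¬¬-minimum x λ (j , j-min) → helper j j-min xi≰xk
  where
  helper : ∀ j → (∀ k → x j ≤ x k) → ¬ ¬ (x i ≤ x k)
  helper j j-min xi≰xk with j Fin.≟ i
  ... | yes refl = xi≰xk (j-min k)
  ... | no  j≢i  = others j j≢i j-min

-- Powers of two and large summands.

^-eventually-≥ : ∀ x K q → Eventually (λ n → ι K ℚ.≤ seq x n) →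
  Eventually (λ n → ι (K ℕ.^ q) ℚ.≤ seq (x ^ q) n)
^-eventually-≥ x K zero    K≤x = 0 , λ _ _ → ℚ.≤-refl
^-eventually-≥ x K (suc q) K≤x = eventually-map (λ n (p , r) → begin
  ι (K ℕ.* K ℕ.^ q)          ≡⟨ ι-* K (K ℕ.^ q) ⟩
  ι K ℚ.* ι (K ℕ.^ q)        ≤⟨ ℚ.*-monoˡ-≤-nonNeg (ι K) {{ℚ.nonNegative (ι-mono {0} {K} ℕ.z≤n)}} r ⟩
  ι K ℚ.* seq (x ^ q) n      ≤⟨ ℚ.*-monoʳ-≤-nonNeg (seq (x ^ q) n) {{ℚ.nonNegative (ℚ.≤-trans (ι-mono {0} {K ℕ.^ q} ℕ.z≤n) r)}} p ⟩
  seq x n ℚ.* seq (x ^ q) n  ∎) (K≤x ∩ ^-eventually-≥ x K q K≤x)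
  where open ℚ.≤-Reasoning

-- A rational `p / q` that is at most `x` satisfies `p ≤ m * q`, hence 2 to the `p` is at most
-- `(2 ^ m) ^ q`, which is at most `y ^ q`.
2^-≤ : ∀ (x : ℝ) q m → (∀ n → seq x n ≡ q) → q ℚ.≤ ι m → ∀ y →
  Eventually (λ n → ι (2 ℕ.^ m) ℚ.≤ seq y n) → 2^ x ≤ y
2^-≤ x r m x≡r r≤m y 2^m≤y p q p/q≤x =
  ≤-pointwise {fromℕ (2 ℕ.^ p)} {y ^ q} (eventually-map (λ n → ℚ.≤-trans (ι-mono 2^p≤2^m^q))
    (^-eventually-≥ y (2 ℕ.^ m) q 2^m≤y))
  where
  p/q≤m : ℤ.+ p ℚ./ q ℚ.≤ ι m
  p/q≤m = ∀δ⇒≤ λ δ 0<δ → let N , h = p/q≤x δ 0<δ in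
    ℚ.≤-trans (h N ℕ.≤-refl) (ℚ.+-monoˡ-≤ δ (subst (ℚ._≤ ι m) (sym (x≡r N)) r≤m))
  2^p≤2^m^q : 2 ℕ.^ p ℕ.≤ (2 ℕ.^ m) ℕ.^ q
  2^p≤2^m^q = subst (2 ℕ.^ p ℕ.≤_) (sym (ℕ.^-*-assoc 2 m q)) (ℕ.^-monoʳ-≤ 2 (/≤ι⇒≤* p q m p/q≤m))

sumℚ : List ℚ → ℚ
sumℚ = List.foldr ℚ._+_ 0ℚ

-- A constructive pigeonhole principle: the gap between `p` and `q` allows `cauchy-choice` to
-- classify each summand as large or small.
some-summand-large : ∀ {A : Set} (x : A → ℝ) (p q : ℚ) → p ℚ.< q → ∀ as →
  Any (λ a → Eventually (λ n → p ℚ.≤ seq (x a) n)) as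
  ⊎ Eventually (λ n → sumℚ (List.map (λ a → seq (x a) n) as) ℚ.≤ ι (length as) ℚ.* q)
some-summand-large x p q p<q []       = inj₂ (0 , λ _ _ → ℚ.≤-reflexive (sym (ℚ.*-zeroˡ q)))
some-summand-large x p q p<q (a ∷ as) = Sum.[ (λ p≤xa → inj₁ (here p≤xa))
  , (λ xa≤q → Sum.map there (λ rest≤ → eventually-map (λ n (u , v) → begin
      seq (x a) n ℚ.+ sumℚ (List.map (λ a → seq (x a) n) as)  ≤⟨ ℚ.+-mono-≤ u v ⟩
      q ℚ.+ ι (length as) ℚ.* q                               ≡⟨ q+l*q≡[1+l]*q (ι (length as)) ⟩
      (1ℚ ℚ.+ ι (length as)) ℚ.* q                            ≡⟨ cong (ℚ._* q) (ι-+ 1 (length as)) ⟨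
      ι (suc (length as)) ℚ.* q                               ∎) (xa≤q ∩ rest≤))
    (some-summand-large x p q p<q as)) ]′ (cauchy-choice (x a) p<q)
  where
  open ℚ.≤-Reasoning
  open +-*-Solver
  q+l*q≡[1+l]*q : ∀ l → q ℚ.+ l ℚ.* q ≡ (1ℚ ℚ.+ l) ℚ.* q
  q+l*q≡[1+l]*q l = solve 2 (λ q l → q :+ l :* q := (con 1ℚ :+ l) :* q) refl q l

-- Complete layered graphs with natural weights

complete : ℕ → ℕ → ℕ → LayeredDAG
complete p k q = record
  { ∣V₁∣ = p ; ∣V₂∣ = k ; ∣V₃∣ = q
  ; adjacent = adjacent
  ; layered  = layered
  }
  where
  V : Set
  V = Fin p ⊎ Fin k ⊎ Fin q

  adjacent : V → V → Bool
  adjacent (inj₁ _)        (inj₂ (inj₁ _)) = true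
  adjacent (inj₂ (inj₁ _)) (inj₂ (inj₂ _)) = true
  adjacent _               _               = false

  layered : ∀ {u v} → T (adjacent u v) → Consecutive u v
  layered {inj₁ a}        {inj₂ (inj₁ b)} _ = V₁→V₂ a b
  layered {inj₂ (inj₁ b)} {inj₂ (inj₂ c)} _ = V₂→V₃ b c

module _ {p k q : ℕ} where
  open LayeredDAG (complete p k q) using (Path)

  through : ∀ s b t → Path (inj₁ s) (inj₂ (inj₂ t))
  through s b t = _◅_ {j = inj₂ (inj₁ b)} tt (tt ◅ ε)

  is-through : ∀ {s t} (π : Path (inj₁ s) (inj₂ (inj₂ t))) → ∃[ b ] π ≡ through s b t
  is-through (_◅_ {j = inj₂ (inj₁ b)} _ (_◅_ {j = inj₂ (inj₂ _)} _ ε)) = b , refl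

  module _ (H : Weighting (complete p k q)) where
    open Weighting H

    weight₁ : Fin p → Fin k → ℝ
    weight₁ s b = weight {inj₁ s} {inj₂ (inj₁ b)} tt

    weight₂ : Fin k → Fin q → ℝ
    weight₂ b t = weight {inj₂ (inj₁ b)} {inj₂ (inj₂ t)} tt

    shortest : ∀ {s b t} → (∀ b′ → pathWeight (through s b t) ≤ pathWeight (through s b′ t)) →
      IsShortest (through s b t)
    shortest {s} {b} {t} b-min π = let b′ , π≡ = is-through π in
      subst (λ π → pathWeight (through s b t) ≤ pathWeight π) (sym π≡) (b-min b′)

module NaturalWeights {p k q : ℕ} (w₁ : Fin p → Fin k → ℕ) (w₂ : Fin k → Fin q → ℕ)
  (w₁>0 : ∀ s b → 1 ℕ.≤ w₁ s b) (w₂>0 : ∀ b t → 1 ℕ.≤ w₂ b t) where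

  open LayeredDAG (complete p k q) using () renaming (Edge to E)

  private
    weight : ∀ {u v} → E u v → ℝ
    weight {inj₁ s}        {inj₂ (inj₁ b)} _ = fromℕ (w₁ s b)
    weight {inj₂ (inj₁ b)} {inj₂ (inj₂ t)} _ = fromℕ (w₂ b t)

    fromℕ-positive : ∀ {n} → 1 ℕ.≤ n → 0ℝ < fromℕ n
    fromℕ-positive 1≤n = 1ℚ , 0<1 , 0 , λ _ _ → ι-mono 1≤n

    positive : ∀ {u v} (e : E u v) → 0ℝ < weight e
    positive {inj₁ s}        {inj₂ (inj₁ b)} _ = fromℕ-positive (w₁>0 s b)
    positive {inj₂ (inj₁ b)} {inj₂ (inj₂ t)} _ = fromℕ-positive (w₂>0 b t)

  G : WeightedLayeredDAG
  G = record { graph = complete p k q ; weighting = record { weight = weight ; positive = positive } }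

  private module G = WeightedLayeredDAG G

  cost : Fin p → Fin k → Fin q → ℕ
  cost s b t = w₁ s b ℕ.+ w₂ b t

  pathWeight-cost : ∀ s b t n → seq (G.pathWeight (through s b t)) n ≡ ι (cost s b t)
  pathWeight-cost s b t n = trans (cong (ι (w₁ s b) ℚ.+_) (ℚ.+-identityʳ (ι (w₂ b t))))
    (sym (ι-+ (w₁ s b) (w₂ b t)))

  module _ {α : ℝ} (A : ℕ) .{{_ : ℕ.NonZero A}} (α≤A : Eventually (λ n → seq α n ℚ.≤ ι A))
    {H : Weighting (complete p k q)} (preserver : IsGap1Preserver α G H)
    {s b₀ t} (others-costly : ∀ b → b ≢ b₀ → A ℕ.* cost s b₀ t ℕ.< cost s b t) where

    private module H = Weighting H

    isDist : G.IsDist (inj₁ s) (inj₂ (inj₂ t)) (G.pathWeight (through s b₀ t))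
    isDist = through s b₀ t
      , shortest G.weighting (λ b → ≤-pointwise {G.pathWeight (through s b₀ t)} {G.pathWeight (through s b t)}
          (0 , λ n _ → subst₂ ℚ._≤_ (sym (pathWeight-cost s b₀ t n)) (sym (pathWeight-cost s b t n)) (ι-mono (cheapest b))))
      , ≤-refl {G.pathWeight (through s b₀ t)} , ≤-refl {G.pathWeight (through s b₀ t)}
      where
      cheapest : ∀ b → cost s b₀ t ℕ.≤ cost s b t
      cheapest b with b Fin.≟ b₀
      ... | yes refl = ℕ.≤-refl
      ... | no  b≢b₀ = ℕ.≤-trans (ℕ.m≤n*m _ A) (ℕ.<⇒≤ (others-costly b b≢b₀))

    -- The stretch bound would put `cost s b t` within ½ above `A * cost s b₀ t`, but these are
    -- natural numbers and the strict inequality keeps them at least 1 apart.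
    others-not-shortest : ∀ b → b ≢ b₀ → ¬ H.IsShortest (through s b t)
    others-not-shortest b b≢b₀ b-shortest = eventually-⊥ (eventually-map (λ n (u , v) →
      ℚ.<-irrefl refl (begin-strict
        ι (A ℕ.* c₀) ℚ.+ ½                                         <⟨ ℚ.+-monoʳ-< (ι (A ℕ.* c₀)) ½<1 ⟩
        ι (A ℕ.* c₀) ℚ.+ 1ℚ                                        ≡⟨ ℚ.+-comm (ι (A ℕ.* c₀)) 1ℚ ⟩
        1ℚ ℚ.+ ι (A ℕ.* c₀)                                        ≡⟨ ι-+ 1 (A ℕ.* c₀) ⟨
        ι (suc (A ℕ.* c₀))                                         ≤⟨ ι-mono (others-costly b b≢b₀) ⟩
        ι (cost s b t)                                             ≡⟨ pathWeight-cost s b t n ⟨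
        seq (G.pathWeight (through s b t)) n                       ≤⟨ v ⟩
        seq α n ℚ.* seq (G.pathWeight (through s b₀ t)) n ℚ.+ ½    ≡⟨ cong (λ c → seq α n ℚ.* c ℚ.+ ½) (pathWeight-cost s b₀ t n) ⟩
        seq α n ℚ.* ι c₀ ℚ.+ ½                                     ≤⟨ ℚ.+-monoˡ-≤ ½ (ℚ.*-monoʳ-≤-nonNeg (ι c₀) {{ℚ.nonNegative (ι-mono {0} {c₀} ℕ.z≤n)}} u) ⟩
        ι A ℚ.* ι c₀ ℚ.+ ½                                         ≡⟨ cong (ℚ._+ ½) (ι-* A c₀) ⟨
        ι (A ℕ.* c₀) ℚ.+ ½                                         ∎))
      (α≤A ∩ proj₁ preserver (through s b t) b-shortest (G.pathWeight (through s b₀ t)) isDist ½ 0<½))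
      where
      open ℚ.≤-Reasoning
      c₀ = cost s b₀ t
      ½<1 : ½ ℚ.< 1ℚ
      ½<1 = 0<δ⇒a<a+δ ½ 0<½

    -- Half of the gap 1 pays for replacing the reals by their n-th approximations.
    forced : ∀ b → b ≢ b₀ → Eventually (λ n →
      seq (weight₁ H s b₀) n ℚ.+ seq (weight₂ H b₀ t) n ℚ.+ ½
        ℚ.≤ seq (weight₁ H s b) n ℚ.+ seq (weight₂ H b t) n)
    forced b b≢b₀ = eventually-map
      (λ n gap → ≤-by-difference gap (solve 4 (λ x y x′ y′ →
          x′ :+ y′ :- (x :+ y :+ con ½) := x′ :+ (y′ :+ con 0ℚ) :+ con ½ :- (x :+ (y :+ con 0ℚ) :+ con 1ℚ)) refl
          (seq (weight₁ H s b₀) n) (seq (weight₂ H b₀ t) n) (seq (weight₁ H s b) n) (seq (weight₂ H b t) n)))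
      (proj₂ preserver (through s b₀ t) (through s b t) b₀-shortest (others-not-shortest b b≢b₀) ½ 0<½)
      where
      open +-*-Solver
      b₀-shortest : H.IsShortest (through s b₀ t)
      b₀-shortest = shortest H (only-candidate⇒minimum (λ b → H.pathWeight (through s b t)) b₀
        (λ b b≢b₀ b-min → others-not-shortest b b≢b₀ (shortest H b-min)))

-- The exponents

-- The test for `j` comes first, so for `j ≡ k` the value is `x` at that vertex and `z` at the two
-- others; the diagonal targets rely on this.
pick : Fin 3 → Fin 3 → ℕ → ℕ → ℕ → Fin 3 → ℕ
pick j k x y z b = if does (b Fin.≟ j) then x else if does (b Fin.≟ k) then y else z

module _ {j k : Fin 3} {x y z : ℕ} where

  pick-first : pick j k x y z j ≡ x
  pick-first rewrite dec-true (j Fin.≟ j) refl = refl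

  pick-second : k ≢ j → pick j k x y z k ≡ y
  pick-second k≢j rewrite dec-false (k Fin.≟ j) k≢j | dec-true (k Fin.≟ k) refl = refl

  pick-third : ∀ {b} → b ≢ j → b ≢ k → pick j k x y z b ≡ z
  pick-third {b} b≢j b≢k rewrite dec-false (b Fin.≟ j) b≢j | dec-false (b Fin.≟ k) b≢k = refl

Label : Set
Label = Fin 3 × Fin 3

Address : Set
Address = ℕ × Label

-- σ u and τ v are the exponents of the source at address u and the target at
-- address v; the targets with equal labels j = k serve in dominated-diagonal.
σ τ : Address → Fin 3 → ℕ
σ (r , j , k) = pick j k 0 (1 ℕ.+ 2 ℕ.* r) (2 ℕ.+ 2 ℕ.* r)
τ (r , j , k) = pick j k (2 ℕ.+ 2 ℕ.* r) 0 (2 ℕ.* r)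

-- The min-max rule with an explicit threshold: `M` separates the larger exponent at `b₀` from the
-- larger exponent at each other middle vertex.
Dominated : Address → Address → Fin 3 → ℕ → Set
Dominated u v b₀ M = (σ u b₀ ℕ.≤ M × τ v b₀ ℕ.≤ M) × (∀ b → b ≢ b₀ → M ℕ.< σ u b ⊎ M ℕ.< τ v b)

module _ (r : ℕ) {j k : Fin 3} (j≢k : j ≢ k) where

  -- The larger exponents are `4 + 2r` at `j`, `5 + 2r` at `k` and `6 + 2r` at the remaining vertex.
  dominated-upper : Dominated (2 ℕ.+ r , j , k) (1 ℕ.+ r , j , k) j (4 ℕ.+ 2 ℕ.* r)
  dominated-upper = (ℕ.≤-trans (ℕ.≤-reflexive (pick-first {j} {k})) ℕ.z≤n
    , ℕ.≤-reflexive (trans (pick-first {j} {k}) (cong (2 ℕ.+_) (ℕ.*-suc 2 r)))) , others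
    where
    others : ∀ b → b ≢ j → _
    others b b≢j with b Fin.≟ k
    ... | yes refl = inj₁ (ℕ.≤-reflexive (sym (trans (pick-second b≢j) (cong suc (ℕ.*-distribˡ-+ 2 2 r)))))
    ... | no  b≢k  = inj₁ (ℕ.≤-trans (ℕ.n≤1+n _)
        (ℕ.≤-reflexive (sym (trans (pick-third b≢j b≢k) (cong (2 ℕ.+_) (ℕ.*-distribˡ-+ 2 2 r))))))

  module _ {l : Fin 3} (l≢j : l ≢ j) (l≢k : l ≢ k) where

    -- The larger exponents are `3 + 2r` at `l` and `4 + 2r` at both `j` and `k`.
    dominated-middle : Dominated (1 ℕ.+ r , j , l) (1 ℕ.+ r , j , k) l (3 ℕ.+ 2 ℕ.* r)
    dominated-middle = (ℕ.≤-reflexive (trans (pick-second l≢j) (cong suc (ℕ.*-suc 2 r)))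
      , ℕ.≤-trans (ℕ.≤-reflexive (trans (pick-third l≢j l≢k) (ℕ.*-suc 2 r))) (ℕ.n≤1+n _)) , others
      where
      others : ∀ b → b ≢ l → _
      others b b≢l with b Fin.≟ j
      ... | yes refl = inj₂ (ℕ.≤-reflexive (sym (trans (pick-first {j} {k}) (cong (2 ℕ.+_) (ℕ.*-suc 2 r)))))
      ... | no  b≢j  = inj₁ (ℕ.≤-reflexive (sym (trans (pick-third b≢j b≢l) (cong (2 ℕ.+_) (ℕ.*-suc 2 r)))))

    -- The larger exponents are `1 + 2r` at `k`, `2 + 2r` at `l` and `4 + 2r` at `j`.
    dominated-lower : Dominated (r , l , k) (1 ℕ.+ r , j , k) k (1 ℕ.+ 2 ℕ.* r)
    dominated-lower = (ℕ.≤-reflexive (pick-second (l≢k ∘ sym))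
      , ℕ.≤-trans (ℕ.≤-reflexive (pick-second (j≢k ∘ sym))) ℕ.z≤n) , others
      where
      others : ∀ b → b ≢ k → _
      others b b≢k with b Fin.≟ l
      ... | yes refl = inj₂ (ℕ.≤-reflexive (sym (trans (pick-third l≢j l≢k) (ℕ.*-suc 2 r))))
      ... | no  b≢l  = inj₁ (ℕ.≤-reflexive (sym (pick-third b≢l b≢k)))

    -- The larger exponents are `2r` at `j`, `1 + 2r` at `k` and `2 + 2r` at `l`. The target treats
    -- `j` and `k` alike, so it also serves the source with these two exchanged.
    dominated-diagonal : Dominated (r , j , k) (r , l , l) j (2 ℕ.* r)
    dominated-diagonal = (ℕ.≤-trans (ℕ.≤-reflexive (pick-first {j} {k})) ℕ.z≤n
      , ℕ.≤-reflexive (pick-third (l≢j ∘ sym) (l≢j ∘ sym))) , others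
      where
      others : ∀ b → b ≢ j → _
      others b b≢j with b Fin.≟ k
      ... | yes refl = inj₁ (ℕ.≤-reflexive (sym (pick-second b≢j)))
      ... | no  b≢k  = inj₁ (ℕ.≤-trans (ℕ.n≤1+n _) (ℕ.≤-reflexive (sym (pick-third b≢j b≢k))))

-- Sums over the ordered pairs of middle vertices.

labels : List Label
labels = (0F , 1F) ∷ (1F , 0F) ∷ (0F , 2F) ∷ (2F , 0F) ∷ (1F , 2F) ∷ (2F , 1F) ∷ []

third : Label → Fin 3
third (0F , 1F) = 2F
third (1F , 0F) = 2F
third (0F , 2F) = 1F
third (2F , 0F) = 1F
-- Meant for `(1F , 2F)` and `(2F , 1F)`; the diagonal labels also land here, but `labels` contains
-- none of them.
third _         = 0F

-- The labels `(j , l)` and `(l , k)` on the smaller side of the recursion for `(j , k)`.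
first second : Label → Label
first  e = proj₁ e , third e
second e = third e , proj₂ e

-- `first`, like `second` below, permutes the six labels, so the sum is only reordered.
sum-first : ∀ x → sumℚ (List.map (λ e → x (first e)) labels) ≡ sumℚ (List.map x labels)
sum-first x = solve 6 (λ a b c d e f →
  c :+ (e :+ (a :+ (f :+ (b :+ (d :+ con 0ℚ))))) := a :+ (b :+ (c :+ (d :+ (e :+ (f :+ con 0ℚ)))))) refl
  (x (0F , 1F)) (x (1F , 0F)) (x (0F , 2F)) (x (2F , 0F)) (x (1F , 2F)) (x (2F , 1F))
  where open +-*-Solver

sum-second : ∀ x → sumℚ (List.map (λ e → x (second e)) labels) ≡ sumℚ (List.map x labels)
sum-second x = solve 6 (λ a b c d e f →
  f :+ (d :+ (e :+ (b :+ (c :+ (a :+ con 0ℚ))))) := a :+ (b :+ (c :+ (d :+ (e :+ (f :+ con 0ℚ)))))) refl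
  (x (0F , 1F)) (x (1F , 0F)) (x (0F , 2F)) (x (2F , 0F)) (x (1F , 2F)) (x (2F , 1F))
  where open +-*-Solver

sumℚ-+ : ∀ {A : Set} (x y : A → ℚ) as →
  sumℚ (List.map (λ a → x a ℚ.+ y a) as) ≡ sumℚ (List.map x as) ℚ.+ sumℚ (List.map y as)
sumℚ-+ x y []       = refl
sumℚ-+ x y (a ∷ as) = trans (cong (x a ℚ.+ y a ℚ.+_) (sumℚ-+ x y as))
  (solve 4 (λ a b c d → a :+ b :+ (c :+ d) := a :+ c :+ (b :+ d)) refl
    (x a) (y a) (sumℚ (List.map x as)) (sumℚ (List.map y as)))
  where open +-*-Solver

sumℚ-mono : ∀ {A : Set} (x y : A → ℕ → ℚ) as →
  All (λ a → Eventually (λ n → x a n ℚ.≤ y a n)) as →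
  Eventually (λ n → sumℚ (List.map (λ a → x a n) as) ℚ.≤ sumℚ (List.map (λ a → y a n) as))
sumℚ-mono x y []       []           = 0 , λ _ _ → ℚ.≤-refl
sumℚ-mono x y (a ∷ as) (x≤y ∷ rest) =
  eventually-map (λ n (p , q) → ℚ.+-mono-≤ p q) (x≤y ∩ sumℚ-mono x y as rest)

-- The graphs with `L` levels.

module Construction (A L : ℕ) .{{_ : ℕ.NonZero A}} .{{_ : ℕ.NonZero L}} where

  B : ℕ
  B = A ℕ.* 2

  instance
    B≢0 : ℕ.NonZero B
    B≢0 = ℕ.m*n≢0 A 2

  -- Meaningful only for levels r < L.
  code : Address → Fin (L ℕ.* (3 ℕ.* 3))
  code (r , j , k) = combine (r mod L) (combine j k)

  decode : Fin (L ℕ.* (3 ℕ.* 3)) → Address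
  decode i = let r , jk = remQuot {L} (3 ℕ.* 3) i in toℕ r , remQuot 3 jk

  decode-code : ∀ {r} j k → r ℕ.< L → decode (code (r , j , k)) ≡ (r , j , k)
  decode-code {r} j k r<L = cong₂ _,_
    (trans (cong (toℕ ∘ proj₁) split) (trans (Fin.toℕ-fromℕ< (m%n<n r L)) (m<n⇒m%n≡m r<L)))
    (trans (cong (remQuot 3 ∘ proj₂) split) (Fin.remQuot-combine j k))
    where
    split : remQuot {L} (3 ℕ.* 3) (code (r , j , k)) ≡ (r mod L , combine j k)
    split = Fin.remQuot-combine (r mod L) (combine j k)

  B^-mono : ∀ {m n} → m ℕ.≤ n → B ℕ.^ m ℕ.≤ B ℕ.^ n
  B^-mono = ℕ.^-monoʳ-≤ B

  open NaturalWeights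
    (λ s b → B ℕ.^ σ (decode s) b) (λ b t → B ℕ.^ τ (decode t) b)
    (λ s b → ℕ.m^n>0 B (σ (decode s) b)) (λ b t → ℕ.m^n>0 B (τ (decode t) b)) public

  -- The factor 2 in `B` pays for the two edges of a path: `A` times two powers of exponent at most
  -- `M` is at most `B ^ suc M`. Strictness comes from the other, positive, summand on the right.
  B^-separates : ∀ {M x y x′ y′} → x ℕ.≤ M → y ℕ.≤ M → M ℕ.< x′ ⊎ M ℕ.< y′ →
    A ℕ.* (B ℕ.^ x ℕ.+ B ℕ.^ y) ℕ.< B ℕ.^ x′ ℕ.+ B ℕ.^ y′
  B^-separates {M} {x} {y} {x′} {y′} x≤M y≤M M<x′⊎M<y′ = begin-strict
    A ℕ.* (B ℕ.^ x ℕ.+ B ℕ.^ y)   ≤⟨ ℕ.*-monoʳ-≤ A (ℕ.+-mono-≤ (B^-mono x≤M) (B^-mono y≤M)) ⟩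
    A ℕ.* (B ℕ.^ M ℕ.+ B ℕ.^ M)   ≡⟨ solve 2 (λ a p → a :* (p :+ p) := a :* con 2 :* p) refl A (B ℕ.^ M) ⟩
    B ℕ.^ suc M                   <⟨ bound M<x′⊎M<y′ ⟩
    B ℕ.^ x′ ℕ.+ B ℕ.^ y′         ∎
    where
    open ℕ.≤-Reasoning
    open ℕ-Solver
    bound : M ℕ.< x′ ⊎ M ℕ.< y′ → B ℕ.^ suc M ℕ.< B ℕ.^ x′ ℕ.+ B ℕ.^ y′
    bound (inj₁ M<x′) = ℕ.≤-<-trans (B^-mono M<x′) (ℕ.m<m+n (B ℕ.^ x′) (ℕ.m^n>0 B y′))
    bound (inj₂ M<y′) = ℕ.≤-<-trans (B^-mono M<y′) (ℕ.m<n+m (B ℕ.^ y′) (ℕ.m^n>0 B x′))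

  -- Constraints on a preserver and exponential growth.

  module _ {α : ℝ} (α≤A : Eventually (λ n → seq α n ℚ.≤ ι A))
    {H : Weighting (graph G)} (preserver : IsGap1Preserver α G H) where

    up : Address → Fin 3 → ℕ → ℚ
    up u b = seq (weight₁ H (code u) b)

    down : Address → Fin 3 → ℕ → ℚ
    down v b = seq (weight₂ H b (code v))

    rise : ℕ → Label → ℕ → ℚ
    rise r (j , k) n = up (r , j , k) k n ℚ.- up (r , j , k) j n

    -- Carries the min-max rule over to the weights of `H`; the bounds by `L` ensure that `decode`
    -- recovers both addresses.
    dominated⇒forced : ∀ {r j k r′ j′ k′ b₀ M} → r ℕ.< L → r′ ℕ.< L →
      Dominated (r , j , k) (r′ , j′ , k′) b₀ M → ∀ b → b ≢ b₀ →
      Eventually (λ n → up (r , j , k) b₀ n ℚ.+ down (r′ , j′ , k′) b₀ n ℚ.+ ½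
        ℚ.≤ up (r , j , k) b n ℚ.+ down (r′ , j′ , k′) b n)
    dominated⇒forced {r} {j} {k} {r′} {j′} {k′} {b₀} r<L r′<L ((σ≤M , τ≤M) , others) =
      forced {α} A α≤A {H} preserver {code (r , j , k)} {b₀} {code (r′ , j′ , k′)} costly
      where
      costly : ∀ b → b ≢ b₀ →
        A ℕ.* cost (code (r , j , k)) b₀ (code (r′ , j′ , k′)) ℕ.< cost (code (r , j , k)) b (code (r′ , j′ , k′))
      costly b b≢b₀ = subst₂
        (λ u v → A ℕ.* (B ℕ.^ σ u b₀ ℕ.+ B ℕ.^ τ v b₀) ℕ.< B ℕ.^ σ u b ℕ.+ B ℕ.^ τ v b)
        (sym (decode-code j k r<L)) (sym (decode-code j′ k′ r′<L)) (B^-separates σ≤M τ≤M (others b b≢b₀))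

    -- The three constraints at the target (1 + r , j , k) add up so that its own
    -- weights cancel.
    rise-recursion : ∀ {r} → 2 ℕ.+ r ℕ.< L → ∀ {j k l} → j ≢ k → l ≢ j → l ≢ k →
      Eventually (λ n → rise (1 ℕ.+ r) (j , l) n ℚ.+ rise r (l , k) n ℚ.≤ rise (2 ℕ.+ r) (j , k) n)
    rise-recursion {r} 2+r<L {j} {k} {l} j≢k l≢j l≢k = eventually-map
      (λ n (p , q , s) → ≤-by-difference
        (ℚ.+-mono-≤ (weaken (a₁ n) (x n) (a₂ n) (y n) p)
          (ℚ.+-mono-≤ (weaken (b₂ n) (z n) (b₁ n) (x n) q) (weaken (c₂ n) (y n) (c₁ n) (z n) s)))
        (solve 9 (λ a₁ a₂ b₁ b₂ c₁ c₂ x y z →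
          (a₂ :- a₁) :- ((b₂ :- b₁) :+ (c₂ :- c₁)) :=
          (a₂ :+ y) :+ ((b₁ :+ x) :+ (c₁ :+ z)) :- ((a₁ :+ x) :+ ((b₂ :+ z) :+ (c₂ :+ y)))) refl
          (a₁ n) (a₂ n) (b₁ n) (b₂ n) (c₁ n) (c₂ n) (x n) (y n) (z n)))
      (dominated⇒forced 2+r<L 1+r<L (dominated-upper r j≢k) k (j≢k ∘ sym)
      ∩ dominated⇒forced 1+r<L 1+r<L (dominated-middle r j≢k l≢j l≢k) j (l≢j ∘ sym)
      ∩ dominated⇒forced r<L 1+r<L (dominated-lower r j≢k l≢j l≢k) l l≢k)
      where
      open +-*-Solver
      a₁ a₂ b₁ b₂ c₁ c₂ x y z : ℕ → ℚ
      a₁ = up (2 ℕ.+ r , j , k) j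
      a₂ = up (2 ℕ.+ r , j , k) k
      b₁ = up (1 ℕ.+ r , j , l) j
      b₂ = up (1 ℕ.+ r , j , l) l
      c₁ = up (r , l , k) l
      c₂ = up (r , l , k) k
      x  = down (1 ℕ.+ r , j , k) j
      y  = down (1 ℕ.+ r , j , k) k
      z  = down (1 ℕ.+ r , j , k) l
      1+r<L : 1 ℕ.+ r ℕ.< L
      1+r<L = ℕ.<⇒≤ 2+r<L
      r<L : r ℕ.< L
      r<L = ℕ.<⇒≤ 1+r<L
      weaken : ∀ p q r s → p ℚ.+ q ℚ.+ ½ ℚ.≤ r ℚ.+ s → p ℚ.+ q ℚ.≤ r ℚ.+ s
      weaken p q r s = ℚ.≤-trans (ℚ.<⇒≤ (0<δ⇒a<a+δ (p ℚ.+ q) 0<½))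

    -- At the diagonal target of `l` one source prefers `j` and the other prefers `k`. In the sum of
    -- the two constraints the weights at the target cancel, and the two slacks ½ add up to 1.
    rise-pair : ∀ {r} → r ℕ.< L → ∀ {j k l} → j ≢ k → l ≢ j → l ≢ k →
      Eventually (λ n → 1ℚ ℚ.≤ rise r (j , k) n ℚ.+ rise r (k , j) n)
    rise-pair {r} r<L {j} {k} {l} j≢k l≢j l≢k = eventually-map
      (λ n (p , q) → ≤-by-difference (ℚ.+-mono-≤ p q)
        (solve 6 (λ a₁ a₂ b₁ b₂ x y →
          ((a₂ :- a₁) :+ (b₂ :- b₁)) :- con 1ℚ :=
          (a₂ :+ y) :+ (b₂ :+ x) :- ((a₁ :+ x :+ con ½) :+ (b₁ :+ y :+ con ½))) refl
          (up (r , j , k) j n) (up (r , j , k) k n)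
          (up (r , k , j) k n) (up (r , k , j) j n)
          (down (r , l , l) j n) (down (r , l , l) k n)))
      (dominated⇒forced r<L r<L (dominated-diagonal r j≢k l≢j l≢k) k (j≢k ∘ sym)
      ∩ dominated⇒forced r<L r<L (dominated-diagonal r (j≢k ∘ sym) l≢k l≢j) j j≢k)
      where open +-*-Solver

    total : ℕ → ℕ → ℚ
    total r n = sumℚ (List.map (λ e → rise r e n) labels)

    total-base : ∀ {r} → r ℕ.< L → Eventually (λ n → 1ℚ ℚ.≤ total r n)
    total-base {r} r<L = eventually-map
      -- The three unordered pairs contribute 1 each; the total 3 is weakened to the 1 that starts
      -- the induction.
      (λ n (p , q , s) → ℚ.≤-trans (ι-mono {1} {3} (ℕ.s≤s ℕ.z≤n)) (≤-by-difference
        (ℚ.+-mono-≤ p (ℚ.+-mono-≤ q s))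
        (solve 6 (λ a b c d e f →
          (a :+ (b :+ (c :+ (d :+ (e :+ (f :+ con 0ℚ)))))) :- con (ι 3) :=
          (a :+ b) :+ ((c :+ d) :+ (e :+ f)) :- con (1ℚ ℚ.+ (1ℚ ℚ.+ 1ℚ))) refl
          (rise r (0F , 1F) n) (rise r (1F , 0F) n) (rise r (0F , 2F) n)
          (rise r (2F , 0F) n) (rise r (1F , 2F) n) (rise r (2F , 1F) n))))
      (rise-pair r<L {0F} {1F} {2F} (λ ()) (λ ()) (λ ())
      ∩ rise-pair r<L {0F} {2F} {1F} (λ ()) (λ ()) (λ ())
      ∩ rise-pair r<L {1F} {2F} {0F} (λ ()) (λ ()) (λ ()))
      where open +-*-Solver

    -- Summing `rise-recursion` over all labels gives reorderings of the two previous totals.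
    total-recursion : ∀ {r} → 2 ℕ.+ r ℕ.< L →
      Eventually (λ n → total (1 ℕ.+ r) n ℚ.+ total r n ℚ.≤ total (2 ℕ.+ r) n)
    total-recursion {r} 2+r<L = eventually-map
      (λ n recursion → begin
        total (1 ℕ.+ r) n ℚ.+ total r n
          ≡⟨ cong₂ ℚ._+_ (sum-first (λ e → rise (1 ℕ.+ r) e n)) (sum-second (λ e → rise r e n)) ⟨
        sumℚ (List.map (λ e → rise (1 ℕ.+ r) (first e) n) labels) ℚ.+ sumℚ (List.map (λ e → rise r (second e) n) labels)
          ≡⟨ sumℚ-+ (λ e → rise (1 ℕ.+ r) (first e) n) (λ e → rise r (second e) n) labels ⟨
        sumℚ (List.map (λ e → rise (1 ℕ.+ r) (first e) n ℚ.+ rise r (second e) n) labels)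
          ≤⟨ recursion ⟩
        total (2 ℕ.+ r) n ∎)
      (sumℚ-mono (λ e n → rise (1 ℕ.+ r) (first e) n ℚ.+ rise r (second e) n) (rise (2 ℕ.+ r)) labels
        ( rise-recursion 2+r<L {0F} {1F} {2F} (λ ()) (λ ()) (λ ())
        ∷ rise-recursion 2+r<L {1F} {0F} {2F} (λ ()) (λ ()) (λ ())
        ∷ rise-recursion 2+r<L {0F} {2F} {1F} (λ ()) (λ ()) (λ ())
        ∷ rise-recursion 2+r<L {2F} {0F} {1F} (λ ()) (λ ()) (λ ())
        ∷ rise-recursion 2+r<L {1F} {2F} {0F} (λ ()) (λ ()) (λ ())
        ∷ rise-recursion 2+r<L {2F} {1F} {0F} (λ ()) (λ ()) (λ ())
        ∷ []))
      where open ℚ.≤-Reasoning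

    -- Carrying two consecutive levels through the induction turns the Fibonacci recursion into a
    -- doubling every two levels.
    total-growth : ∀ m → 1 ℕ.+ m ℕ.* 2 ℕ.< L →
      Eventually (λ n → ι (2 ℕ.^ m) ℚ.≤ total (m ℕ.* 2) n × ι (2 ℕ.^ m) ℚ.≤ total (1 ℕ.+ m ℕ.* 2) n)
    total-growth zero    1<L = total-base (ℕ.<⇒≤ 1<L) ∩ total-base 1<L
    total-growth (suc m) 3+2m<L = eventually-map
      (λ n ((p , q) , u , v) →
        let 2^m+2^m≤total = ℚ.≤-trans (ℚ.+-mono-≤ q p) u in
          (begin
            ι (2 ℕ.^ suc m)                        ≡⟨ ι-2^suc ⟩
            ι (2 ℕ.^ m) ℚ.+ ι (2 ℕ.^ m)            ≤⟨ 2^m+2^m≤total ⟩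
            total (2 ℕ.+ m ℕ.* 2) n                ∎)
        , (begin
            ι (2 ℕ.^ suc m)                                      ≡⟨ ι-2^suc ⟩
            ι (2 ℕ.^ m) ℚ.+ ι (2 ℕ.^ m)                          ≤⟨ 2^m+2^m≤total ⟩
            total (2 ℕ.+ m ℕ.* 2) n                              ≡⟨ ℚ.+-identityʳ (total (2 ℕ.+ m ℕ.* 2) n) ⟨
            -- At the odd level the even one just below it suffices, since the other summand is
            -- nonnegative.
            total (2 ℕ.+ m ℕ.* 2) n ℚ.+ 0ℚ                       ≤⟨ ℚ.+-monoʳ-≤ (total (2 ℕ.+ m ℕ.* 2) n) (ℚ.≤-trans (ι-mono {0} {2 ℕ.^ m} ℕ.z≤n) q) ⟩
            total (2 ℕ.+ m ℕ.* 2) n ℚ.+ total (1 ℕ.+ m ℕ.* 2) n  ≤⟨ v ⟩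
            total (3 ℕ.+ m ℕ.* 2) n                              ∎))
      (total-growth m 1+2m<L ∩ total-recursion (ℕ.<⇒≤ 3+2m<L) ∩ total-recursion 3+2m<L)
      where
      open ℚ.≤-Reasoning
      1+2m<L : 1 ℕ.+ m ℕ.* 2 ℕ.< L
      1+2m<L = ℕ.<⇒≤ (ℕ.<⇒≤ 3+2m<L)
      ι-2^suc : ι (2 ℕ.^ suc m) ≡ ι (2 ℕ.^ m) ℚ.+ ι (2 ℕ.^ m)
      ι-2^suc = trans (cong (λ k → ι (2 ℕ.^ m ℕ.+ k)) (ℕ.+-identityʳ (2 ℕ.^ m))) (ι-+ (2 ℕ.^ m) (2 ℕ.^ m))

    -- With `K = 2 ^ m`, the total at level `R` is at least `16 * K` and at most the sum of six edge
    -- weights. If none of the six were eventually at least `K`, all would eventually be at most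
    -- `suc K`, but `6 * suc K` is less than `16 * K`.
    heavy-edge : ∀ m → 1 ℕ.+ (4 ℕ.+ m) ℕ.* 2 ℕ.< L →
      ∃[ s ] ∃[ b ] Eventually (λ n → ι (2 ℕ.^ m) ℚ.≤ seq (weight₁ H s b) n)
    heavy-edge m R<L =
      Sum.[ (λ large → let e , 2^m≤ = satisfied large in code (R , e) , proj₂ e , 2^m≤)
          , (λ small → ⊥-elim (eventually-⊥ (eventually-map (λ n (u , (v , _) , w) →
              ℚ.<-irrefl refl (begin-strict
                ι 6 ℚ.* ι (suc K)                                  ≡⟨ ι-* 6 (suc K) ⟨
                ι (6 ℕ.* suc K)                                    <⟨ ι<ι-suc (6 ℕ.* suc K) ⟩
                ι (suc (6 ℕ.* suc K))                              ≤⟨ ι-mono 6*suc<16* ⟩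
                ι (2 ℕ.^ (4 ℕ.+ m))                                ≤⟨ v ⟩
                total R n                                          ≤⟨ w ⟩
                sumℚ (List.map (λ e → seq (top e) n) labels)       ≤⟨ u ⟩
                ι 6 ℚ.* ι (suc K)                                  ∎))
            (small ∩ total-growth (4 ℕ.+ m) R<L ∩ total≤top)))) ]′
        (some-summand-large top (ι K) (ι (suc K)) (ι<ι-suc K) labels)
      where
      open ℚ.≤-Reasoning
      R K : ℕ
      R = (4 ℕ.+ m) ℕ.* 2
      K = 2 ℕ.^ m
      top : Label → ℝ
      top e = weight₁ H (code (R , e)) (proj₂ e)
      ι<ι-suc : ∀ n → ι n ℚ.< ι (suc n)
      ι<ι-suc n = subst (ι n ℚ.<_) (trans (ℚ.+-comm (ι n) 1ℚ) (sym (ι-+ 1 n))) (0<δ⇒a<a+δ (ι n) 0<1)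
      6*suc<16* : 6 ℕ.* suc K ℕ.< 2 ℕ.^ (4 ℕ.+ m)
      6*suc<16* = ℕ.≤-trans (ℕ.≤-reflexive (solve 1 (λ k → con 1 :+ con 6 :* (con 1 :+ k) := con 6 :* k :+ con 7) refl K))
        -- Since `K` is positive, 7 is at most `10 * K`.
        (ℕ.≤-trans (ℕ.+-monoʳ-≤ (6 ℕ.* K) (ℕ.*-mono-≤ {7} {10} (ℕ.m≤m+n 7 3) (ℕ.m^n>0 2 m)))
          (ℕ.≤-reflexive (solve 1 (λ k → con 6 :* k :+ con 10 :* k := con 2 :* (con 2 :* (con 2 :* (con 2 :* k)))) refl K)))
        where open ℕ-Solver
      -- The subtracted weight, that of the edge to `j`, is positive.
      rise≤top : ∀ e → Eventually (λ n → rise R e n ℚ.≤ seq (top e) n)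
      rise≤top (j , k) =
        let δ , 0<δ , δ≤bottom = Weighting.positive H {inj₁ (code (R , j , k))} {inj₂ (inj₁ j)} tt in
        eventually-map (λ n 0+δ≤bottom → ≤-by-difference (ℚ.≤-trans (ℚ.<⇒≤ (0<δ⇒a<a+δ 0ℚ 0<δ)) 0+δ≤bottom)
          (rearrange (up (R , j , k) k n) (up (R , j , k) j n))) δ≤bottom
        where
        open +-*-Solver
        rearrange : ∀ a b → a ℚ.- (a ℚ.- b) ≡ b ℚ.- 0ℚ
        rearrange = solve 2 (λ a b → a :- (a :- b) := b :- con 0ℚ) refl
      total≤top : Eventually (λ n → total R n ℚ.≤ sumℚ (List.map (λ e → seq (top e) n) labels))
      total≤top = sumℚ-mono (rise R) (λ e → seq (top e)) labels (All.universal rise≤top labels)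

-- Choice of the constant and of the family.

theorem1p6 : ∀ (α : ℝ) → 1ℝ < α →
    Σ[ c ∈ ℝ ] 0ℝ < c ×
    Σ[ 𝓖 ∈ (ℕ → WeightedLayeredDAG) ]
    (∀ n → ∃[ i ] n ℕ.≤ ∣V∣ (𝓖 i)) ×
    (∀ i → ∣V₂∣ (𝓖 i) ≡ 3 ×
    (∀ (H : Weighting (graph (𝓖 i))) → IsGap1Preserver α (𝓖 i) H →
    Σ[ u ∈ Vertex (𝓖 i) ] Σ[ v ∈ Vertex (𝓖 i) ] Σ[ e ∈ Edge (𝓖 i) u v ]
    2^ (c * fromℕ (∣V∣ (𝓖 i))) ≤ Weighting.weight H e))
theorem1p6 α _ =
  fromℚ c , (c , ℚ.positive⁻¹ c , 0 , λ _ _ → ℚ.≤-reflexive (ℚ.+-identityˡ c)) , 𝓖 , unbounded , λ i → refl , λ H preserver →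
    -- For `m = suc i` the required bound is `11 + 2i < 12 + 2i`, so `levels i` is just large
    -- enough.
    let s , b , 2^1+i≤w = Construction.heavy-edge A (levels i) {α} α≤A {H} preserver (suc i) ℕ.≤-refl in
    inj₁ s , inj₂ (inj₁ b) , tt ,
    2^-≤ (fromℚ c * fromℕ (∣V∣ (𝓖 i))) (c ℚ.* ι (∣V∣ (𝓖 i))) (suc i) (λ _ → refl) (c*∣V∣≤1+i i) (weight₁ H s b) 2^1+i≤w
  where
  -- There are 9 sources and 9 targets per level and 3 middle vertices, so 219 is the number of
  -- vertices for `i = 0`, and `219 * suc i` bounds it for every `i`.
  c : ℚ
  c = ℤ.+ 1 ℚ./ 219

  A₀ A : ℕ
  A₀ = proj₁ (bounded-by-ι α)
  -- The successor makes the bound on `α` nonzero, as `Construction` demands.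
  A  = suc A₀

  α≤A : Eventually (λ n → seq α n ℚ.≤ ι A)
  α≤A = eventually-map (λ n α≤A₀ → ℚ.≤-trans α≤A₀ (ι-mono (ℕ.n≤1+n A₀))) (proj₂ (bounded-by-ι α))

  levels : ℕ → ℕ
  levels i = 12 ℕ.+ i ℕ.* 2

  𝓖 : ℕ → WeightedLayeredDAG
  𝓖 i = Construction.G A (levels i)

  ∣V∣-linear : ∀ i → ∣V∣ (𝓖 i) ≡ 219 ℕ.+ 36 ℕ.* i
  ∣V∣-linear = solve 1 (λ i →
      (con 12 :+ i :* con 2) :* con 9 :+ con 3 :+ (con 12 :+ i :* con 2) :* con 9 := con 219 :+ con 36 :* i) refl
    where open ℕ-Solver

  unbounded : ∀ n → ∃[ i ] n ℕ.≤ ∣V∣ (𝓖 i)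
  unbounded n = n , ℕ.≤-trans (ℕ.m≤n*m n 36)
    (ℕ.≤-trans (ℕ.m≤n+m (36 ℕ.* n) 219) (ℕ.≤-reflexive (sym (∣V∣-linear n))))

  ∣V∣≤219*[1+i] : ∀ i → ∣V∣ (𝓖 i) ℕ.≤ 219 ℕ.* suc i
  ∣V∣≤219*[1+i] i = begin
    ∣V∣ (𝓖 i)               ≡⟨ ∣V∣-linear i ⟩
    219 ℕ.+ 36 ℕ.* i        ≤⟨ ℕ.+-monoʳ-≤ 219 (ℕ.*-monoˡ-≤ i (ℕ.m≤m+n 36 183)) ⟩
    219 ℕ.+ 219 ℕ.* i       ≡⟨ ℕ.*-suc 219 i ⟨
    219 ℕ.* suc i           ∎
    where open ℕ.≤-Reasoning

  c*∣V∣≤1+i : ∀ i → c ℚ.* ι (∣V∣ (𝓖 i)) ℚ.≤ ι (suc i)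
  c*∣V∣≤1+i i = begin
    c ℚ.* ι (∣V∣ (𝓖 i))          ≤⟨ ℚ.*-monoˡ-≤-nonNeg c (ι-mono (∣V∣≤219*[1+i] i)) ⟩
    c ℚ.* ι (219 ℕ.* suc i)      ≡⟨ cong (c ℚ.*_) (ι-* 219 (suc i)) ⟩
    c ℚ.* (ι 219 ℚ.* ι (suc i))  ≡⟨ ℚ.*-assoc c (ι 219) (ι (suc i)) ⟨
    1ℚ ℚ.* ι (suc i)             ≡⟨ ℚ.*-identityˡ (ι (suc i)) ⟩
    ι (suc i)                    ∎
    where open ℚ.≤-Reasoning
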